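{- For every $d \in \{2,3,4,5,8,12,16,24,40\}$, the sequence $\left(\left\lfloor n^4/d \right\rfloor\right)_{n \ge 1}$ is eventually prime-free.
   Context: A sequence $(a_n)_{n\ge 1}$ of positive integers is called eventually prime-free if there exists an index $n_0$ such that $a_n$ is composite for all $n \ge n_0$. (Here, as in the paper, this is understood as: only finitely many terms $a_n$ are prime.) -}

module Defs where

open import Data.Nat using (ℕ; _≤_)
open import Data.Nat.Primality using (Composite)
open import Data.Product using (∃-syntax; _×_)

-- A sequence (aₙ)_{n ≥ 1} is a function on ℕ whose value at 0 is ignored,
-- which is why the threshold n₀ is required to be a genuine index (1 ≤ n₀).
-- Terms are allowed to be 0 because early terms of ⌊n⁴/d⌋ vanish;
-- neither 0 nor 1 is Composite.
EventuallyPrimeFree : (ℕ → ℕ) → Set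
EventuallyPrimeFree a = ∃[ n₀ ] (1 ≤ n₀ × (∀ n → n₀ ≤ n → Composite (a n)))

{-# OPTIONS --safe #-}
-- For each listed d, every fourth power leaves a perfect square s² as its
-- remainder mod d.  Then ⌊n⁴/d⌋ · d = n⁴ − s² = (n² − s)(n² + s), and once both
-- factors exceed d the quotient cannot be prime: a prime dividing one of the
-- factors would force the other one to divide d.
module Submission where

open import Data.Nat using (ℕ; zero; suc; NonZero; _+_; _*_; _∸_; _^_; _≤_; _<_; z≤n; _≟_; >-nonZero; >-nonZero⁻¹; n>1⇒nonTrivial)
open import Data.Nat.Properties
open import Data.Nat.Divisibility using (_∣_; divides; ∣⇒≤)
open import Data.Nat.DivMod using (_/_; _%_; m≡m%n+[m/n]*n; m%n<n; m%n%n≡m%n; %-distribˡ-*)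
open import Data.Nat.Primality using (Prime; Composite; ¬prime⇒composite; euclidsLemma; prime⇒nonZero)
open import Data.Nat.Tactic.RingSolver using (solve-∀)
open import Data.List using (List; []; _∷_)
open import Data.List.Membership.Propositional using (_∈_)
open import Data.List.Relation.Unary.Any using (here; there)
open import Data.Product using (∃-syntax; _×_; _,_)
open import Data.Sum using (inj₁; inj₂)
open import Relation.Nullary using (¬_; Dec)
open import Relation.Nullary.Decidable using (True; toWitness)
open import Relation.Binary.PropositionalEquality using (_≡_; refl; sym; trans; cong; subst; module ≡-Reasoning)
open import Defs

-- Writing `x` as `q * p` and cancelling `p` leaves `d ≡ q * y`, so `y` divides the nonzero `d`.
prime-divides-factor⇒cofactor≤ : ∀ {p d x y} .{{_ : NonZero d}} →
  Prime p → p * d ≡ x * y → p ∣ x → y ≤ d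
prime-divides-factor⇒cofactor≤ {p} {d} {_} {y} p-prime pd≡xy (divides q refl) =
  ∣⇒≤ (divides q (*-cancelˡ-≡ d (q * y) p (trans pd≡xy (rearrange q p y))))
  where
  instance _ = prime⇒nonZero p-prime
  rearrange : ∀ q p y → q * p * y ≡ p * (q * y)
  rearrange = solve-∀

large-factors⇒¬prime : ∀ {m d} x y .{{_ : NonZero d}} →
  d < x → d < y → m * d ≡ x * y → ¬ Prime m
large-factors⇒¬prime {m} {d} x y d<x d<y md≡xy m-prime
  with euclidsLemma x y m-prime (divides d (trans (sym md≡xy) (*-comm m d)))
... | inj₁ m∣x = <⇒≱ d<y (prime-divides-factor⇒cofactor≤ m-prime md≡xy m∣x)
... | inj₂ m∣y = <⇒≱ d<x (prime-divides-factor⇒cofactor≤ m-prime (trans md≡xy (*-comm x y)) m∣y)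

-- Beyond non-primality only 0 and 1 must be ruled out: `m * d` is at least `y`, which exceeds `d`.
large-factors⇒composite : ∀ {m d} x y .{{_ : NonZero d}} →
  d < x → d < y → m * d ≡ x * y → Composite m
large-factors⇒composite {m} {d} x y d<x d<y md≡xy =
  ¬prime⇒composite {{n>1⇒nonTrivial 1<m}} (large-factors⇒¬prime x y d<x d<y md≡xy)
  where
  open ≤-Reasoning
  instance _ = >-nonZero (≤-<-trans z≤n d<x)
  1<m : 1 < m
  1<m = *-cancelʳ-< d 1 m (begin-strict
    1 * d  ≡⟨ *-identityˡ d ⟩
    d      <⟨ d<y ⟩
    y      ≤⟨ m≤n*m y x ⟩
    x * y  ≡⟨ md≡xy ⟨
    m * d  ∎)

^-distribˡ-% : ∀ m k d .{{_ : NonZero d}} → m ^ k % d ≡ (m % d) ^ k % d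
^-distribˡ-% m zero    d = refl
^-distribˡ-% m (suc k) d = begin
  m * m ^ k % d                             ≡⟨ %-distribˡ-* m (m ^ k) d ⟩
  (m % d) * (m ^ k % d) % d                 ≡⟨ cong (λ r → (m % d) * r % d) (^-distribˡ-% m k d) ⟩
  -- A second reduction of `m` is inserted so that the product rule can be read backwards with
  -- `m % d` in place of `m`.
  (m % d) * ((m % d) ^ k % d) % d           ≡⟨ cong (λ r → r * ((m % d) ^ k % d) % d) (m%n%n≡m%n m d) ⟨
  (m % d % d) * ((m % d) ^ k % d) % d       ≡⟨ %-distribˡ-* (m % d) ((m % d) ^ k) d ⟨
  (m % d) * (m % d) ^ k % d                 ∎
  where open ≡-Reasoning

-- The remainder itself must be a square in ℕ, not just a square modulo `d`, since n⁴ - s² has to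
-- equal the quotient times `d` exactly. The bound `s < d` makes the search finite and loses no
-- root, as s ≤ s² < d.
QuarticResiduesAreSquares : (d : ℕ) .{{_ : NonZero d}} → Set
QuarticResiduesAreSquares d = ∀ {r} → r < d → ∃[ s ] (s < d × r ^ 4 % d ≡ s * s)

quarticResiduesAreSquares? : ∀ d .{{_ : NonZero d}} → Dec (QuarticResiduesAreSquares d)
quarticResiduesAreSquares? d = allUpTo? (λ r → anyUpTo? (λ s → r ^ 4 % d ≟ s * s) d) d

-- The threshold gives n² ≥ n ≥ 2d > s + d, so n² - s is a genuine difference and already exceeds
-- `d`.
square-residue⇒composite : ∀ {d n s} .{{_ : NonZero d}} → 2 * d ≤ n → s < d →
  n ^ 4 % d ≡ s * s → Composite (n ^ 4 / d)
square-residue⇒composite {d} {n} {s} 2d≤n s<d n⁴%d≡s² =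
  -- `x + 2 * s` is n² + s expressed through `x`, which keeps the factorisation free of subtraction.
  large-factors⇒composite x (x + 2 * s) d<x (<-≤-trans d<x (m≤m+n x (2 * s))) factored
  where
  x = n * n ∸ s

  s+d<n² : s + d < n * n
  s+d<n² = begin-strict
    s + d    <⟨ +-monoˡ-< d s<d ⟩
    d + d    ≡⟨ cong (d +_) (+-identityʳ d) ⟨
    2 * d    ≤⟨ 2d≤n ⟩
    n        ≤⟨ m≤m*n n n {{>-nonZero (<-≤-trans (>-nonZero⁻¹ d) (≤-trans (m≤n*m d 2) 2d≤n))}} ⟩
    n * n    ∎
    where open ≤-Reasoning

  d<x : d < x
  d<x = subst (_< x) (m+n∸m≡n s d) (∸-monoˡ-< s+d<n² (m≤m+n s d))

  n²≡s+x : n * n ≡ s + x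
  n²≡s+x = sym (m+[n∸m]≡n (≤-trans (m≤m+n s d) (<⇒≤ s+d<n²)))

  -- The left side is the form to which `n ^ 4` unfolds by definition.
  ^4≡square² : ∀ n → n * (n * (n * (n * 1))) ≡ (n * n) * (n * n)
  ^4≡square² = solve-∀

  expand : ∀ s x → (s + x) * (s + x) ≡ s * s + x * (x + 2 * s)
  expand = solve-∀

  factored : n ^ 4 / d * d ≡ x * (x + 2 * s)
  -- With s² added, both sides become n⁴: the left by division with remainder, the right as a
  -- difference of squares.
  factored = +-cancelˡ-≡ (s * s) _ _ (begin
    s * s + n ^ 4 / d * d        ≡⟨ cong (_+ n ^ 4 / d * d) n⁴%d≡s² ⟨
    n ^ 4 % d + n ^ 4 / d * d    ≡⟨ m≡m%n+[m/n]*n (n ^ 4) d ⟨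
    n ^ 4                        ≡⟨ ^4≡square² n ⟩
    (n * n) * (n * n)            ≡⟨ cong (λ t → t * t) n²≡s+x ⟩
    (s + x) * (s + x)            ≡⟨ expand s x ⟩
    s * s + x * (x + 2 * s)      ∎)
    where open ≡-Reasoning

-- The remainder of n⁴ depends only on `n % d`, so the finitely many residues below `d` account for
-- every `n`.
quarticResiduesAreSquares⇒eventuallyPrimeFree : ∀ d .{{_ : NonZero d}} →
  QuarticResiduesAreSquares d → EventuallyPrimeFree (λ n → (n ^ 4) / d)
quarticResiduesAreSquares⇒eventuallyPrimeFree d squares =
  2 * d , ≤-trans (>-nonZero⁻¹ d) (m≤n*m d 2) , composite
  where
  composite : ∀ n → 2 * d ≤ n → Composite (n ^ 4 / d)
  composite n 2d≤n with squares (m%n<n n d)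
  ... | s , s<d , eq = square-residue⇒composite 2d≤n s<d (trans (^-distribˡ-% n 4 d) eq)

-- For a numeral `d` the decision procedure evaluates during type checking: `True` reduces to the
-- unit type and the implicit argument is filled in automatically.
eventuallyPrimeFree-by-residues : ∀ d .{{_ : NonZero d}} →
  {True (quarticResiduesAreSquares? d)} → EventuallyPrimeFree (λ n → (n ^ 4) / d)
eventuallyPrimeFree-by-residues d {checked} =
  quarticResiduesAreSquares⇒eventuallyPrimeFree d (toWitness checked)

theorem3 : (d : ℕ) .{{_ : NonZero d}} →
    d ∈ (2 ∷ 3 ∷ 4 ∷ 5 ∷ 8 ∷ 12 ∷ 16 ∷ 24 ∷ 40 ∷ []) →
    EventuallyPrimeFree (λ n → (n ^ 4) / d)
theorem3 _ (here refl) = eventuallyPrimeFree-by-residues 2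
theorem3 _ (there (here refl)) = eventuallyPrimeFree-by-residues 3
theorem3 _ (there (there (here refl))) = eventuallyPrimeFree-by-residues 4
theorem3 _ (there (there (there (here refl)))) = eventuallyPrimeFree-by-residues 5
theorem3 _ (there (there (there (there (here refl))))) = eventuallyPrimeFree-by-residues 8
theorem3 _ (there (there (there (there (there (here refl)))))) = eventuallyPrimeFree-by-residues 12
theorem3 _ (there (there (there (there (there (there (here refl))))))) = eventuallyPrimeFree-by-residues 16
theorem3 _ (there (there (there (there (there (there (there (here refl)))))))) = eventuallyPrimeFree-by-residues 24
theorem3 _ (there (there (there (there (there (there (there (there (here refl))))))))) = eventuallyPrimeFree-by-residues 40
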